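{- Let $N>3$ be an integer and let \[ S_N = \left\{\{i,j\}\subseteq [N] \;\middle|\; i\neq j,\ \{i,j\}\subseteq \{1,\dots,\lfloor N/2\rfloor\} \text{ or } \{i,j\}\subseteq\{\lfloor N/2\rfloor+1,\dots,N\}\right\},\qquad \mathcal{C}_N = \{A_S^N \mid S\in S_N\}. \] Then $\mathcal{C}_N$ is a clique cover of $J(N,3)$. If moreover $N>7$, then $\mathcal{C}_N$ is a minimal clique cover, i.e. $|\mathcal{C}_N| = \theta(J(N,3))$.
   Context: For integers $0<k<N$, let $[N]=\{1,\dots,N\}$ and let $\mathcal{P}_k([N])$ be the set of $k$-element subsets of $[N]$. The Johnson graph $J(N,k)$ has vertex set $\mathcal{P}_k([N])$, two vertices $S_1,S_2$ being adjacent iff $|S_1\cap S_2| = k-1$. For $S\in\mathcal{P}_{k-1}([N])$, $A_S^N = \{S\cup\{x\}\mid x\in[N]\setminus S\}$, which is (the vertex set of) a clique in $J(N,k)$. A (vertex) clique cover of a graph $G$ is a collection of cliques of $G$ whose vertex sets together contain every vertex of $G$; $\theta(G)$ denotes the smallest cardinality of a clique cover of $G$, and a minimal clique cover is one of cardinality $\theta(G)$. -}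

module Defs where

open import Data.Nat using (ℕ; zero; suc; _<_; _≤_; _∸_; _≟_; _<?_; _≤?_)
open import Data.Nat.DivMod using (_/_)
open import Data.Bool using (true; false)
open import Data.Fin using (Fin; toℕ)
open import Data.Fin.Subset using (Subset; _∈_; _∉_; _∩_; _∪_; ⁅_⁆; ∣_∣)
open import Data.Fin.Subset.Properties using (_∈?_)
open import Data.Fin.Properties using (all?)
open import Data.Vec using (_∷_; [])
open import Data.List using (List; []; _∷_; _++_; map; filter)
open import Data.List.Relation.Unary.All using (All)
open import Data.List.Relation.Unary.Any using (Any)
open import Data.Product using (Σ; ∃; _×_; _,_)
open import Data.Sum using (_⊎_)
open import Relation.Binary.PropositionalEquality using (_≡_; _≢_)
open import Relation.Nullary using (Dec; _×-dec_; _⊎-dec_; _→-dec_)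
open import Level using (0ℓ) renaming (suc to lsuc)

-- Convention: [N] = {1,…,N} is represented by Fin N via i ↦ toℕ i + 1.
-- A subset of [N] is a Subset N (= Vec Bool N); ∣ s ∣ is its cardinality.

IsVertex : (N k : ℕ) → Subset N → Set
IsVertex N k s = ∣ s ∣ ≡ k

Adjacent : (N k : ℕ) → Subset N → Subset N → Set
Adjacent N k s t = ∣ s ∩ t ∣ ≡ k ∸ 1

VSet : ℕ → Set₁
VSet N = Subset N → Set

IsClique : (N k : ℕ) → VSet N → Set
IsClique N k C =
  (∀ s → C s → IsVertex N k s) ×
  (∀ s t → C s → C t → s ≢ t → Adjacent N k s t)

IsCliqueCover : (N k : ℕ) → List (VSet N) → Set₁
IsCliqueCover N k L =
  All (IsClique N k) L ×
  (∀ s → IsVertex N k s → Any (λ C → C s) L)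

A : (N : ℕ) → Subset N → VSet N
A N S T = ∃ λ (x : Fin N) → x ∉ S × T ≡ S ∪ ⁅ x ⁆

allSubsets : (N : ℕ) → List (Subset N)
allSubsets zero = [] ∷ []
allSubsets (suc n) = map (true ∷_) (allSubsets n) ++ map (false ∷_) (allSubsets n)

-- Membership in S_N: a 2-subset {i,j} (i ≠ j) contained in {1,…,⌊N/2⌋}
-- or in {⌊N/2⌋+1,…,N}.  In Fin-coordinates: toℕ i < ⌊N/2⌋, resp. ⌊N/2⌋ ≤ toℕ i.
InSN : (N : ℕ) → Subset N → Set
InSN N s = ∣ s ∣ ≡ 2 ×
  ((∀ i → i ∈ s → toℕ i < N / 2) ⊎ (∀ i → i ∈ s → N / 2 ≤ toℕ i))

InSN? : (N : ℕ) → (s : Subset N) → Dec (InSN N s)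
InSN? N s = (∣ s ∣ ≟ 2) ×-dec
  ( all? (λ i → (i ∈? s) →-dec (toℕ i <? N / 2))
  ⊎-dec all? (λ i → (i ∈? s) →-dec (N / 2 ≤? toℕ i)))

SN : (N : ℕ) → List (Subset N)
SN N = filter (InSN? N) (allSubsets N)

CN : (N : ℕ) → List (VSet N)
CN N = map (A N) (SN N)

{-# OPTIONS --safe #-}
module Submission where

-- A clique of J(N,3) is a star (all its triples contain a common pair) or a block
-- (its triples lie in a common four-set, so there are at most four of them).
-- Given a cover with m stars and f blocks, let H be the graph on [N] of the pairs
-- that are not centres of stars.  Every triangle of H lies in a block, so H has at
-- most 4 f triangles, while it misses at most m pairs.  Goodman's lower bound for
-- the number of triangles in terms of the number of edges, e(4e − N²)/(3N), then
-- forces m + f to be at least the number of pairs inside the two halves of [N].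
-- The halves cover since two elements of any triple lie in the same half.

open import Defs
open import Data.Bool using (true; false)
open import Data.Fin using (Fin; zero; suc; toℕ)
import Data.Fin.Properties as Fin
open import Data.Fin.Subset
  using (Subset; _∈_; _∉_; _⊆_; _⊈_; _∩_; _∪_; _-_; ∁; ⊥; ⁅_⁆; ∣_∣; Nonempty)
open import Data.Fin.Subset.Properties
open import Data.List using (List; []; _∷_; length; lookup; map; filter; _++_)
open import Data.List.Membership.Propositional using () renaming (_∈_ to _∈ˡ_)
open import Data.List.Membership.Propositional.Properties
  using (∈-++⁺ˡ; ∈-++⁺ʳ; ∈-map⁺; ∈-filter⁺; ∈-lookup)
open import Data.List.Properties using (length-++; length-map; filter-++; filter-none)
import Data.List.Relation.Unary.All as All
import Data.List.Relation.Unary.All.Properties as All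
open import Data.List.Relation.Unary.Any as Any using (Any; here)
import Data.List.Relation.Unary.Any.Properties as Any
open import Data.Nat
  using (ℕ; zero; suc; _+_; _*_; _∸_; _<_; _≤_; z≤n; s≤s; z<s; _≟_; _≤?_; _<?_)
open import Data.Nat.Combinatorics using (_C_; nCk+nC[k+1]≡[n+1]C[k+1]; nC1≡n)
open import Data.Nat.DivMod using (_/_; _%_; m≡m%n+[m/n]*n; m%n<n; m/n≤m; /-monoˡ-≤)
open import Data.Nat.Properties
open import Algebra.Properties.Semiring.Sum +-*-semiring
  using (sum; sum-cong-≗; sum-replicate-zero; ∑-distrib-+; ∑-comm; *-distribˡ-sum; *-distribʳ-sum; sum-syntax)
open import Data.Nat.Tactic.RingSolver using (solve-∀)
open import Data.Product using (∃; ∃₂; _×_; _,_; proj₁; proj₂)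
open import Data.Sum using (_⊎_; inj₁; inj₂; [_,_]′; swap)
open import Data.Vec as Vec using ([]; _∷_; here; there)
open import Data.Vec.Properties using ([]=⇒lookup)
open import Function using (_∘_; id)
open import Level using (0ℓ)
open import Relation.Binary.PropositionalEquality
open import Relation.Nullary using (yes; no; ¬_; ¬?; does; contradiction; _×-dec_)
open import Relation.Nullary.Decidable using (True; toWitness; decidable-stable; map′)
open import Relation.Unary using (Pred; Decidable)

private variable
  n : ℕ

-- Cardinalities of subsets

∣p∪q∣+∣p∩q∣≡∣p∣+∣q∣ : ∀ (p q : Subset n) → ∣ p ∪ q ∣ + ∣ p ∩ q ∣ ≡ ∣ p ∣ + ∣ q ∣
∣p∪q∣+∣p∩q∣≡∣p∣+∣q∣ []          []          = refl
∣p∪q∣+∣p∩q∣≡∣p∣+∣q∣ (false ∷ p) (false ∷ q) = ∣p∪q∣+∣p∩q∣≡∣p∣+∣q∣ p q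
∣p∪q∣+∣p∩q∣≡∣p∣+∣q∣ (true  ∷ p) (false ∷ q) = cong suc (∣p∪q∣+∣p∩q∣≡∣p∣+∣q∣ p q)
∣p∪q∣+∣p∩q∣≡∣p∣+∣q∣ (false ∷ p) (true  ∷ q) =
  trans (cong suc (∣p∪q∣+∣p∩q∣≡∣p∣+∣q∣ p q)) (sym (+-suc ∣ p ∣ ∣ q ∣))
∣p∪q∣+∣p∩q∣≡∣p∣+∣q∣ (true  ∷ p) (true  ∷ q) =
  cong suc (trans (+-suc _ _) (trans (cong suc (∣p∪q∣+∣p∩q∣≡∣p∣+∣q∣ p q)) (sym (+-suc ∣ p ∣ ∣ q ∣))))

∣p∩q∣+∣p∩∁q∣≡∣p∣ : ∀ (p q : Subset n) → ∣ p ∩ q ∣ + ∣ p ∩ ∁ q ∣ ≡ ∣ p ∣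
∣p∩q∣+∣p∩∁q∣≡∣p∣ []          []          = refl
∣p∩q∣+∣p∩∁q∣≡∣p∣ (false ∷ p) (x     ∷ q) = ∣p∩q∣+∣p∩∁q∣≡∣p∣ p q
∣p∩q∣+∣p∩∁q∣≡∣p∣ (true  ∷ p) (true  ∷ q) = cong suc (∣p∩q∣+∣p∩∁q∣≡∣p∣ p q)
∣p∩q∣+∣p∩∁q∣≡∣p∣ (true  ∷ p) (false ∷ q) = trans (+-suc _ _) (cong suc (∣p∩q∣+∣p∩∁q∣≡∣p∣ p q))

x∉p-x : ∀ {x} (p : Subset n) → x ∉ p - x
x∉p-x {x = zero}  (_ ∷ p) ()
x∉p-x {x = suc x} (_ ∷ p) (there x∈) = x∉p-x p x∈

x∈p-y⇒x≢y : ∀ {x y} (p : Subset n) → x ∈ p - y → x ≢ y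
x∈p-y⇒x≢y p x∈ refl = x∉p-x p x∈

x∈p⇒p≡p-x∪⁅x⁆ : ∀ {x} {p : Subset n} → x ∈ p → p ≡ (p - x) ∪ ⁅ x ⁆
x∈p⇒p≡p-x∪⁅x⁆ {x = x} {p} x∈p = ⊆-antisym to from
  where
  to : p ⊆ (p - x) ∪ ⁅ x ⁆
  to {y} y∈p with y Fin.≟ x
  ... | yes refl = x∈p∪q⁺ (inj₂ (x∈⁅x⁆ x))
  ... | no y≢x   = x∈p∪q⁺ (inj₁ (x∈p∧x≢y⇒x∈p-y y∈p y≢x))
  from : (p - x) ∪ ⁅ x ⁆ ⊆ p
  from y∈ with x∈p∪q⁻ (p - x) ⁅ x ⁆ y∈
  ... | inj₁ y∈p-x = p─q⊆p p ⁅ x ⁆ y∈p-x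
  ... | inj₂ y∈⁅x⁆ rewrite x∈⁅y⁆⇒x≡y x y∈⁅x⁆ = x∈p

x∉p⇒∣p∪⁅x⁆∣≡1+∣p∣ : ∀ {x} {p : Subset n} → x ∉ p → ∣ p ∪ ⁅ x ⁆ ∣ ≡ suc ∣ p ∣
x∉p⇒∣p∪⁅x⁆∣≡1+∣p∣ {n} {x} {p} x∉p = begin
  ∣ p ∪ ⁅ x ⁆ ∣                      ≡⟨ +-identityʳ _ ⟨
  ∣ p ∪ ⁅ x ⁆ ∣ + 0                  ≡⟨ cong (∣ p ∪ ⁅ x ⁆ ∣ +_) ∣p∩⁅x⁆∣≡0 ⟨
  ∣ p ∪ ⁅ x ⁆ ∣ + ∣ p ∩ ⁅ x ⁆ ∣      ≡⟨ ∣p∪q∣+∣p∩q∣≡∣p∣+∣q∣ p ⁅ x ⁆ ⟩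
  ∣ p ∣ + ∣ ⁅ x ⁆ ∣                  ≡⟨ cong (∣ p ∣ +_) (∣⁅x⁆∣≡1 x) ⟩
  ∣ p ∣ + 1                          ≡⟨ +-comm ∣ p ∣ 1 ⟩
  suc ∣ p ∣                          ∎
  where
  open ≡-Reasoning
  disjoint : ¬ Nonempty (p ∩ ⁅ x ⁆)
  disjoint (y , y∈) with x∈p∩q⁻ p ⁅ x ⁆ y∈
  ... | y∈p , y∈⁅x⁆ rewrite x∈⁅y⁆⇒x≡y x y∈⁅x⁆ = x∉p y∈p
  ∣p∩⁅x⁆∣≡0 : ∣ p ∩ ⁅ x ⁆ ∣ ≡ 0
  ∣p∩⁅x⁆∣≡0 = trans (cong ∣_∣ (Empty-unique disjoint)) (∣⊥∣≡0 n)

x∈p⇒1+∣p-x∣≡∣p∣ : ∀ {x} {p : Subset n} → x ∈ p → suc ∣ p - x ∣ ≡ ∣ p ∣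
x∈p⇒1+∣p-x∣≡∣p∣ {p = p} x∈p =
  trans (sym (x∉p⇒∣p∪⁅x⁆∣≡1+∣p∣ (x∉p-x p))) (cong ∣_∣ (sym (x∈p⇒p≡p-x∪⁅x⁆ x∈p)))

0<∣p∣⇒Nonempty : ∀ {p : Subset n} → 0 < ∣ p ∣ → Nonempty p
0<∣p∣⇒Nonempty {n} {p} 0<∣p∣ with nonempty? p
... | yes ne = ne
... | no  ¬ne rewrite Empty-unique ¬ne | ∣⊥∣≡0 n = contradiction 0<∣p∣ λ ()

2≤∣p∣⇒distinct : ∀ {p : Subset n} → 2 ≤ ∣ p ∣ → ∃₂ λ x y → x ∈ p × y ∈ p × x ≢ y
2≤∣p∣⇒distinct {p = p} 2≤ =
  let x , x∈p   = 0<∣p∣⇒Nonempty (≤-trans (s≤s z≤n) 2≤)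
      y , y∈p-x = 0<∣p∣⇒Nonempty (≤-pred (subst (2 ≤_) (sym (x∈p⇒1+∣p-x∣≡∣p∣ x∈p)) 2≤))
  in  x , y , x∈p , p─q⊆p p ⁅ x ⁆ y∈p-x , x∈p-y⇒x≢y p y∈p-x ∘ sym

∣p∣≤1⇒x≡y : ∀ {p : Subset n} → ∣ p ∣ ≤ 1 → ∀ {x y} → x ∈ p → y ∈ p → x ≡ y
∣p∣≤1⇒x≡y {p = p} ∣p∣≤1 {x} {y} x∈p y∈p with x Fin.≟ y
... | yes x≡y = x≡y
... | no  x≢y = contradiction
  (≤-trans (x∈p⇒∣p-x∣<∣p∣ (x∈p∧x≢y⇒x∈p-y x∈p x≢y)) (≤-pred (≤-trans (x∈p⇒∣p-x∣<∣p∣ y∈p) ∣p∣≤1)))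
  λ ()

-- Counting the pairs inside the two halves

length-filter-⊎ : ∀ {A : Set} {P Q R : Pred A 0ℓ} (P? : Decidable P) (Q? : Decidable Q) (R? : Decidable R) →
  (∀ x → P x → Q x ⊎ R x) → ∀ xs →
  length (filter P? xs) ≤ length (filter Q? xs) + length (filter R? xs)
length-filter-⊎ P? Q? R? P⊆Q⊎R []       = z≤n
length-filter-⊎ P? Q? R? P⊆Q⊎R (x ∷ xs)
  with ih ← length-filter-⊎ P? Q? R? P⊆Q⊎R xs | P? x | Q? x | R? x
... | no _   | no _   | no _   = ih
... | no _   | yes _  | no _   = m≤n⇒m≤1+n ih
... | no _   | no _   | yes _  = ≤-trans ih (+-monoʳ-≤ _ (n≤1+n _))
... | no _   | yes _  | yes _  = m≤n⇒m≤1+n (≤-trans ih (+-monoʳ-≤ _ (n≤1+n _)))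
... | yes _  | yes _  | no _   = s≤s ih
... | yes _  | yes _  | yes _  = s≤s (≤-trans ih (+-monoʳ-≤ _ (n≤1+n _)))
... | yes _  | no _   | yes _  = ≤-trans (s≤s ih) (≤-reflexive (sym (+-suc _ _)))
... | yes px | no ¬qx | no ¬rx = contradiction (P⊆Q⊎R x px) [ ¬qx , ¬rx ]′

length-filter-map : ∀ {A B : Set} {P : Pred B 0ℓ} (P? : Decidable P) (f : A → B) xs →
  length (filter P? (map f xs)) ≡ length (filter (P? ∘ f) xs)
length-filter-map P? f []       = refl
length-filter-map P? f (x ∷ xs) with does (P? (f x))
... | true  = cong suc (length-filter-map P? f xs)
... | false = length-filter-map P? f xs

∈-allSubsets : (s : Subset n) → s ∈ˡ allSubsets n
∈-allSubsets []          = here refl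
∈-allSubsets (true  ∷ s) = ∈-++⁺ˡ (∈-map⁺ (true ∷_) (∈-allSubsets s))
∈-allSubsets {suc n} (false ∷ s) =
  ∈-++⁺ʳ (map (true ∷_) (allSubsets n)) (∈-map⁺ (false ∷_) (∈-allSubsets s))

-- Pascal's rule, splitting the subsets by whether they contain the first element. `P` is kept
-- arbitrary so that the induction can pass to `P ∘ (true ∷_)` and `P ∘ (false ∷_)`.
count-subsets : ∀ {P : Pred (Subset n) 0ℓ} (P? : Decidable P) (p : Subset n) k →
  (∀ s → P s → ∣ s ∣ ≡ k × s ⊆ p) → length (filter P? (allSubsets n)) ≤ ∣ p ∣ C k
count-subsets {zero} P? [] k P⇒ with P? []
... | no _  = z≤n
... | yes p with refl , _ ← P⇒ [] p = ≤-refl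
count-subsets {suc n} {P} P? (b ∷ p) k P⇒ = begin
  length (filter P? (allSubsets (suc n)))                          ≡⟨ cong length (filter-++ P? (map (true ∷_) xs) _) ⟩
  length (filter P? (map (true ∷_) xs) ++ filter P? (map (false ∷_) xs)) ≡⟨ length-++ (filter P? (map (true ∷_) xs)) ⟩
  length (filter P? (map (true ∷_) xs)) + length (filter P? (map (false ∷_) xs))
    ≡⟨ cong₂ _+_ (length-filter-map P? _ xs) (length-filter-map P? _ xs) ⟩
  length (filter P?₁ xs) + length (filter P?₀ xs)                  ≤⟨ bound b k P⇒ ⟩
  ∣ b ∷ p ∣ C k                                                    ∎
  where
  open ≤-Reasoning
  xs  = allSubsets n
  P?₁ : Decidable (P ∘ (true ∷_))
  P?₁ = P? ∘ (true ∷_)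
  P?₀ : Decidable (P ∘ (false ∷_))
  P?₀ = P? ∘ (false ∷_)
  none : (∀ s → ¬ P (true ∷ s)) → length (filter P?₁ xs) ≡ 0
  none ¬P = cong length (filter-none P?₁ (All.universal ¬P xs))
  without : ∀ {b k} → (∀ s → P s → ∣ s ∣ ≡ k × s ⊆ b ∷ p) → length (filter P?₀ xs) ≤ ∣ p ∣ C k
  without P⇒ = count-subsets P?₀ p _ λ s Ps → proj₁ (P⇒ _ Ps) , drop-∷-⊆ (proj₂ (P⇒ _ Ps))
  bound : ∀ b k → (∀ s → P s → ∣ s ∣ ≡ k × s ⊆ b ∷ p) →
    length (filter P?₁ xs) + length (filter P?₀ xs) ≤ ∣ b ∷ p ∣ C k
  -- No counted subset contains the first element here: it lies outside `false ∷ p`, and in the next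
  -- clause the size is zero.
  bound false k P⇒ rewrite none (λ s Ps → contradiction (proj₂ (P⇒ _ Ps) here) λ ()) = without P⇒
  bound true zero P⇒ rewrite none (λ s Ps → contradiction (proj₁ (P⇒ _ Ps)) λ ()) = without P⇒
  bound true (suc k) P⇒ = ≤-trans
    (+-mono-≤ (count-subsets P?₁ p k λ s Ps → suc-injective (proj₁ (P⇒ _ Ps)) , drop-∷-⊆ (proj₂ (P⇒ _ Ps)))
              (without P⇒))
    (≤-reflexive (nCk+nC[k+1]≡[n+1]C[k+1] ∣ p ∣ k))

below : ∀ n → ℕ → Subset n
below zero    _       = []
below (suc n) zero    = false ∷ below n zero
below (suc n) (suc h) = true ∷ below n h

∣below∣≡ : ∀ {n h} → h ≤ n → ∣ below n h ∣ ≡ h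
∣below∣≡ {zero}  z≤n       = refl
∣below∣≡ {suc n} z≤n       = ∣below∣≡ {n} z≤n
∣below∣≡         (s≤s h≤n) = cong suc (∣below∣≡ h≤n)

∈below⁺ : ∀ {h} {i : Fin n} → toℕ i < h → i ∈ below n h
∈below⁺ {i = zero}  z<s       = here
∈below⁺ {i = suc i} (s≤s i<h) = there (∈below⁺ i<h)

∈below⁻ : ∀ {h} {i : Fin n} → i ∈ below n h → toℕ i < h
∈below⁻ {suc n} {suc h} {zero}  here       = z<s
∈below⁻ {suc n} {zero}  {suc i} (there i∈) = contradiction (∈below⁻ i∈) λ ()
∈below⁻ {suc n} {suc h} {suc i} (there i∈) = s≤s (∈below⁻ i∈)

length-CN≤ : ∀ N → length (CN N) ≤ (N / 2) C 2 + (N ∸ N / 2) C 2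
length-CN≤ N = begin
  length (CN N)                                       ≡⟨ length-map (A N) (SN N) ⟩
  length (SN N)                                       ≤⟨ length-filter-⊎ (InSN? N) (Q? low) (Q? (∁ low)) split (allSubsets N) ⟩
  length (filter (Q? low) (allSubsets N)) + length (filter (Q? (∁ low)) (allSubsets N))
    ≤⟨ +-mono-≤ (count-subsets (Q? low) low 2 (λ _ → id)) (count-subsets (Q? (∁ low)) (∁ low) 2 (λ _ → id)) ⟩
  ∣ low ∣ C 2 + ∣ ∁ low ∣ C 2                         ≡⟨ cong₂ _+_ (cong (_C 2) ∣low∣≡) (cong (_C 2) ∣high∣≡) ⟩
  (N / 2) C 2 + (N ∸ N / 2) C 2                       ∎
  where
  open ≤-Reasoning
  low = below N (N / 2)
  Q? : (p : Subset N) → Decidable (λ s → ∣ s ∣ ≡ 2 × s ⊆ p)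
  Q? p s = (∣ s ∣ ≟ 2) ×-dec (s ⊆? p)
  split : ∀ s → InSN N s → (∣ s ∣ ≡ 2 × s ⊆ low) ⊎ (∣ s ∣ ≡ 2 × s ⊆ ∁ low)
  split s (∣s∣≡2 , inj₁ s<) = inj₁ (∣s∣≡2 , λ i∈s → ∈below⁺ (s< _ i∈s))
  split s (∣s∣≡2 , inj₂ s≥) = inj₂ (∣s∣≡2 , λ i∈s → x∉p⇒x∈∁p (≤⇒≯ (s≥ _ i∈s) ∘ ∈below⁻))
  ∣low∣≡ : ∣ low ∣ ≡ N / 2
  ∣low∣≡ = ∣below∣≡ (m/n≤m N 2)
  ∣high∣≡ : ∣ ∁ low ∣ ≡ N ∸ N / 2
  ∣high∣≡ = trans (∣∁p∣≡n∸∣p∣ low) (cong (N ∸_) ∣low∣≡)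

-- The cover by pairs inside the two halves

A-isClique : ∀ {N} {S : Subset N} → ∣ S ∣ ≡ 2 → IsClique N 3 (A N S)
A-isClique {N} {S} ∣S∣≡2 = vertex , adjacent
  where
  vertex : ∀ s → A N S s → ∣ s ∣ ≡ 3
  vertex _ (x , x∉S , refl) = trans (x∉p⇒∣p∪⁅x⁆∣≡1+∣p∣ x∉S) (cong suc ∣S∣≡2)
  adjacent : ∀ s t → A N S s → A N S t → s ≢ t → ∣ s ∩ t ∣ ≡ 2
  adjacent _ _ (x , _ , refl) (y , _ , refl) s≢t = trans (cong ∣_∣ (⊆-antisym to from)) ∣S∣≡2
    where
    from : S ⊆ (S ∪ ⁅ x ⁆) ∩ (S ∪ ⁅ y ⁆)
    from z∈S = x∈p∩q⁺ (x∈p∪q⁺ (inj₁ z∈S) , x∈p∪q⁺ (inj₁ z∈S))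
    to : (S ∪ ⁅ x ⁆) ∩ (S ∪ ⁅ y ⁆) ⊆ S
    to z∈ with z∈₁ , z∈₂ ← x∈p∩q⁻ (S ∪ ⁅ x ⁆) _ z∈
          with x∈p∪q⁻ S ⁅ x ⁆ z∈₁ | x∈p∪q⁻ S ⁅ y ⁆ z∈₂
    ... | inj₁ z∈S | _        = z∈S
    ... | inj₂ _   | inj₁ z∈S = z∈S
    ... | inj₂ z∈x | inj₂ z∈y = contradiction
      (cong (λ w → S ∪ ⁅ w ⁆) (trans (sym (x∈⁅y⁆⇒x≡y x z∈x)) (x∈⁅y⁆⇒x≡y y z∈y))) s≢t

-- Applied with `p` and `q` the two halves in either order. If `s` misses `p` altogether, any
-- element of `s` may be removed.
remove-outlier : ∀ {s p q : Subset n} → Nonempty s → (∀ x → x ∈ p ⊎ x ∈ q) → ∣ s ∩ p ∣ ≤ 1 →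
  ∃ λ x → x ∈ s × s - x ⊆ q
remove-outlier {s = s} {p} {q} (x₀ , x₀∈s) p∪q ≤1 with nonempty? (s ∩ p)
... | yes (x , x∈s∩p) = x , p∩q⊆p s p x∈s∩p , λ {y} y∈ →
  [ (λ y∈p → contradiction (∣p∣≤1⇒x≡y ≤1 (x∈p∩q⁺ (p─q⊆p s ⁅ x ⁆ y∈ , y∈p)) x∈s∩p) (x∈p-y⇒x≢y s y∈))
  , id ]′ (p∪q y)
... | no empty = x₀ , x₀∈s , λ {y} y∈ →
  [ (λ y∈p → contradiction (y , x∈p∩q⁺ (p─q⊆p s ⁅ x₀ ⁆ y∈ , y∈p)) empty) , id ]′ (p∪q y)

-- One of the halves contains at most one element of a given triple. Removing an outlier leaves a
-- pair inside the other half, and that pair is the centre of a clique containing the triple.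
CN-isCliqueCover : ∀ N → IsCliqueCover N 3 (CN N)
CN-isCliqueCover N =
  All.map⁺ (All.map (A-isClique ∘ proj₁) (All.all-filter (InSN? N) (allSubsets N))) , covers
  where
  low = below N (N / 2)
  module Removal (s : Subset N) (∣s∣≡3 : ∣ s ∣ ≡ 3) where
    nonempty : Nonempty s
    nonempty = 0<∣p∣⇒Nonempty (subst (0 <_) (sym ∣s∣≡3) z<s)
    via : ∀ {q} → (∃ λ x → x ∈ s × s - x ⊆ q) →
      (∀ {t : Subset N} → t ⊆ q → (∀ i → i ∈ t → toℕ i < N / 2) ⊎ (∀ i → i ∈ t → N / 2 ≤ toℕ i)) →
      Any (λ C → C s) (CN N)
    via (x , x∈s , s-x⊆q) side =
      Any.map⁺ (Any.map (λ { refl → x , x∉p-x s , x∈p⇒p≡p-x∪⁅x⁆ x∈s })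
        (∈-filter⁺ (InSN? N) (∈-allSubsets (s - x))
          (suc-injective (trans (x∈p⇒1+∣p-x∣≡∣p∣ x∈s) ∣s∣≡3) , side s-x⊆q)))
  split : ∀ x → x ∈ low ⊎ x ∈ ∁ low
  split x with x ∈? low
  ... | yes x∈ = inj₁ x∈
  ... | no  x∉ = inj₂ (x∉p⇒x∈∁p x∉)
  covers : ∀ s → ∣ s ∣ ≡ 3 → Any (λ C → C s) (CN N)
  covers s ∣s∣≡3 with ∣ s ∩ low ∣ ≤? 1
  ... | yes ≤1 = via (remove-outlier nonempty split ≤1)
                     λ s⊆ → inj₂ λ i i∈ → ≮⇒≥ (x∈∁p⇒x∉p (s⊆ i∈) ∘ ∈below⁺)
    where open Removal s ∣s∣≡3
  ... | no  ≰1 = via (remove-outlier nonempty (swap ∘ split) high≤1)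
                     λ s⊆ → inj₁ λ i i∈ → ∈below⁻ (s⊆ i∈)
    where
    open Removal s ∣s∣≡3
    high≤1 : ∣ s ∩ ∁ low ∣ ≤ 1
    high≤1 = +-cancelˡ-≤ 2 _ _ (≤-trans (+-monoˡ-≤ _ (≰⇒> ≰1))
      (≤-reflexive (trans (∣p∩q∣+∣p∩∁q∣≡∣p∣ s low) ∣s∣≡3)))

-- Goodman's inequality and the resulting arithmetic

sum-mono : {f g : Fin n → ℕ} → (∀ i → f i ≤ g i) → sum f ≤ sum g
sum-mono {zero}  f≤g = z≤n
sum-mono {suc n} f≤g = +-mono-≤ (f≤g zero) (sum-mono (f≤g ∘ suc))

sum-const : ∀ n c → ∑[ i < n ] c ≡ n * c
sum-const zero    c = refl
sum-const (suc n) c = cong (c +_) (sum-const n c)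

sum-zero : {f : Fin n → ℕ} → (∀ i → f i ≡ 0) → sum f ≡ 0
sum-zero {n} f≡0 = trans (sum-cong-≗ f≡0) (sum-replicate-zero n)

term≤sum : (f : Fin n → ℕ) (i : Fin n) → f i ≤ sum f
term≤sum f zero    = m≤m+n _ _
term≤sum f (suc i) = ≤-trans (term≤sum (f ∘ suc) i) (m≤n+m _ _)

2xy≤x²+y² : ∀ x y → 2 * (x * y) ≤ x * x + y * y
2xy≤x²+y² x y with ≤-total x y
... | inj₁ x≤y with k , refl ← m≤n⇒∃[o]m+o≡n x≤y = m+n≤o⇒m≤o _ (≤-reflexive (eq x k))
  where eq : ∀ x k → 2 * (x * (x + k)) + k * k ≡ x * x + (x + k) * (x + k)
        eq = solve-∀
... | inj₂ y≤x with k , refl ← m≤n⇒∃[o]m+o≡n y≤x = m+n≤o⇒m≤o _ (≤-reflexive (eq y k))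
  where eq : ∀ y k → 2 * ((y + k) * y) + k * k ≡ (y + k) * (y + k) + y * y
        eq = solve-∀

-- Cauchy-Schwarz against the all-ones vector. In the induction the cross term `2 * (x * s)` is
-- bounded summand by summand with `2xy≤x²+y²`.
sum²≤n*sum-squares : (f : Fin n → ℕ) → sum f * sum f ≤ n * ∑[ i < n ] (f i * f i)
sum²≤n*sum-squares {zero}  f = z≤n
sum²≤n*sum-squares {suc n} f = begin
  (x + s) * (x + s)                          ≡⟨ expand x s ⟩
  x * x + 2 * (x * s) + s * s                ≤⟨ +-mono-≤ (+-monoʳ-≤ (x * x) cross) (sum²≤n*sum-squares (f ∘ suc)) ⟩
  x * x + (n * (x * x) + q) + n * q          ≡⟨ collect n (x * x) q ⟩
  suc n * (x * x + q)                        ∎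
  where
  open ≤-Reasoning
  x = f zero
  s = ∑[ i < n ] f (suc i)
  q = ∑[ i < n ] (f (suc i) * f (suc i))
  expand : ∀ x s → (x + s) * (x + s) ≡ x * x + 2 * (x * s) + s * s
  expand = solve-∀
  collect : ∀ n y q → y + (n * y + q) + n * q ≡ (1 + n) * (y + q)
  collect = solve-∀
  cross : 2 * (x * s) ≤ n * (x * x) + q
  cross = begin
    2 * (x * s)                                     ≡⟨ cong (2 *_) (*-distribˡ-sum x (f ∘ suc)) ⟩
    2 * ∑[ i < n ] (x * f (suc i))                    ≡⟨ *-distribˡ-sum 2 (λ i → x * f (suc i)) ⟩
    ∑[ i < n ] (2 * (x * f (suc i)))                  ≤⟨ sum-mono (λ i → 2xy≤x²+y² x (f (suc i))) ⟩
    ∑[ i < n ] (x * x + f (suc i) * f (suc i))      ≡⟨ ∑-distrib-+ {n} (λ _ → x * x) (λ i → f (suc i) * f (suc i)) ⟩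
    ∑[ i < n ] (x * x) + q                            ≡⟨ cong (_+ q) (sum-const n (x * x)) ⟩
    n * (x * x) + q                                 ∎

-- Goodman's bound: an edge ij lies in at least dᵢ + dⱼ − n triangles; sum over
-- the edges and bound the sum of squared degrees below by Cauchy–Schwarz.
goodman : (a : Fin n → Fin n → ℕ) → (∀ i j → a i j ≤ 1) →
  let D = ∑[ i < n ] ∑[ j < n ] a i j
      T = ∑[ i < n ] ∑[ j < n ] ∑[ k < n ] (a i j * (a i k * a k j))
  in  2 * (D * D) ≤ n * (T + n * D)
goodman {n} a a≤1 = begin
  -- One copy of `D * D` is expanded by rows and the other by columns, so that both ends of a pair
  -- contribute their degrees.
  2 * (D * D)                       ≡⟨ cong (D * D +_) (+-identityʳ (D * D)) ⟩
  D * D + D * D                     ≡⟨ cong (λ d → D * D + d * d) (∑-comm a) ⟩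
  D * D + sum col * sum col         ≤⟨ +-mono-≤ (sum²≤n*sum-squares row) (sum²≤n*sum-squares col) ⟩
  n * R² + n * C²                   ≡⟨ *-distribˡ-+ n R² C² ⟨
  n * (R² + C²)                     ≤⟨ *-monoʳ-≤ n paths ⟩
  n * (T + n * D)                   ∎
  where
  open ≤-Reasoning
  D  = ∑[ i < n ] ∑[ j < n ] a i j
  T  = ∑[ i < n ] ∑[ j < n ] ∑[ k < n ] (a i j * (a i k * a k j))
  row col : Fin n → ℕ
  row i = ∑[ j < n ] a i j
  col j = ∑[ i < n ] a i j
  R² = ∑[ i < n ] (row i * row i)
  C² = ∑[ j < n ] (col j * col j)
  row-eq : ∀ i → row i * row i ≡ ∑[ j < n ] ∑[ k < n ] (a i j * a i k)
  row-eq i = trans (*-distribʳ-sum (row i) (a i)) (sum-cong-≗ λ j → *-distribˡ-sum (a i j) (a i))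
  col-eq : ∀ j → col j * col j ≡ ∑[ i < n ] ∑[ k < n ] (a i j * a k j)
  col-eq j = trans (*-distribʳ-sum (col j) (λ i → a i j))
                   (sum-cong-≗ λ i → *-distribˡ-sum (a i j) (λ k → a k j))
  -- For `x = 1` this is `y + z ≤ y * z + 1`: a vertex `k` is counted twice among the neighbours of
  -- `i` and `j` only if it closes a triangle. Summing over `k` gives the bound dᵢ + dⱼ - n.
  bits : ∀ {x y z} → x ≤ 1 → y ≤ 1 → z ≤ 1 → x * y + x * z ≤ x * (y * z) + x
  bits {y = y} {z} z≤n       _         _         = z≤n
  bits {z = z}     (s≤s z≤n) z≤n       (z≤n)     = z≤n
  bits             (s≤s z≤n) z≤n       (s≤s z≤n) = s≤s z≤n
  bits             (s≤s z≤n) (s≤s z≤n) z≤n       = s≤s z≤n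
  bits             (s≤s z≤n) (s≤s z≤n) (s≤s z≤n) = s≤s (s≤s z≤n)
  merge : ∀ {m} (f g : Fin m → Fin n → Fin n → ℕ) →
    ∑[ i < m ] ∑[ j < n ] ∑[ k < n ] f i j k + ∑[ i < m ] ∑[ j < n ] ∑[ k < n ] g i j k
      ≡ ∑[ i < m ] ∑[ j < n ] ∑[ k < n ] (f i j k + g i j k)
  merge f g = sym (trans
    (sum-cong-≗ λ i → trans (sum-cong-≗ λ j → ∑-distrib-+ (f i j) (g i j))
                            (∑-distrib-+ (λ j → sum (f i j)) (λ j → sum (g i j))))
    (∑-distrib-+ (λ i → ∑[ j < n ] sum (f i j)) (λ i → ∑[ j < n ] sum (g i j))))
  nD-eq : n * D ≡ ∑[ i < n ] ∑[ j < n ] ∑[ k < n ] a i j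
  nD-eq = trans (*-distribˡ-sum n row)
    (sum-cong-≗ λ i → trans (*-distribˡ-sum n (a i)) (sum-cong-≗ λ j → sym (sum-const n (a i j))))
  paths : R² + C² ≤ T + n * D
  paths = begin
    R² + C²
      ≡⟨ cong₂ _+_ (sum-cong-≗ row-eq)
           (trans (sum-cong-≗ col-eq) (∑-comm λ j i → ∑[ k < n ] (a i j * a k j))) ⟩
    ∑[ i < n ] ∑[ j < n ] ∑[ k < n ] (a i j * a i k) + ∑[ i < n ] ∑[ j < n ] ∑[ k < n ] (a i j * a k j)
      ≡⟨ merge (λ i j k → a i j * a i k) (λ i j k → a i j * a k j) ⟩
    ∑[ i < n ] ∑[ j < n ] ∑[ k < n ] (a i j * a i k + a i j * a k j)
      ≤⟨ sum-mono (λ i → sum-mono λ j → sum-mono λ k → bits (a≤1 i j) (a≤1 i k) (a≤1 k j)) ⟩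
    ∑[ i < n ] ∑[ j < n ] ∑[ k < n ] (a i j * (a i k * a k j) + a i j)
      ≡⟨ merge (λ i j k → a i j * (a i k * a k j)) (λ i j k → a i j) ⟨
    T + ∑[ i < n ] ∑[ j < n ] ∑[ k < n ] a i j
      ≡⟨ cong (T +_) nD-eq ⟨
    T + n * D ∎

2*nC2+n≡n² : ∀ n → 2 * (n C 2) + n ≡ n * n
2*nC2+n≡n² zero    = refl
2*nC2+n≡n² (suc n) = begin
  2 * (suc n C 2) + suc n       ≡⟨ cong (λ c → 2 * c + suc n) (nCk+nC[k+1]≡[n+1]C[k+1] n 1) ⟨
  2 * (n C 1 + n C 2) + suc n   ≡⟨ cong (λ c → 2 * (c + n C 2) + suc n) (nC1≡n n) ⟩
  2 * (n + n C 2) + suc n       ≡⟨ rearrange n (n C 2) ⟩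
  2 * (n C 2) + n + (1 + 2 * n) ≡⟨ cong (_+ (1 + 2 * n)) (2*nC2+n≡n² n) ⟩
  n * n + (1 + 2 * n)           ≡⟨ square n ⟩
  suc n * suc n                 ∎
  where
  open ≡-Reasoning
  rearrange : ∀ n c → 2 * (n + c) + (1 + n) ≡ 2 * c + n + (1 + 2 * n)
  rearrange = solve-∀
  square : ∀ n → n * n + (1 + 2 * n) ≡ (1 + n) * (1 + n)
  square = solve-∀

-- This is where N > 7 enters: for N = 7 (h = 3, g = 4) the inequality fails.
Separation : ℕ → ℕ → ℕ → Set
Separation h g f = 12 * (h + g) * f < (h * g + f + 1) * (4 * f + 3)

-- The difference of the sides is `4f² + (4hg + 7 − 12(h + g))f + 3hg + 3`. Once `h` and `g` are at
-- least 6 its linear coefficient is positive, so after the shift by 6 all coefficients are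
-- nonnegative.
separation-large : ∀ k l f → Separation (6 + k) (6 + l) f
separation-large k l f = m+n≤o⇒m≤o _ (≤-reflexive (eq k l f))
  where
  eq : ∀ k l f → 1 + 12 * (6 + k + (6 + l)) * f
                   + (110 + 18 * (k + l) + 3 * (k * l) + 7 * f + 12 * (k + l) * f + 4 * (k * l) * f + 4 * (f * f))
                 ≡ ((6 + k) * (6 + l) + f + 1) * (4 * f + 3)
  eq = solve-∀

-- For the halves of size 4 and 5 the linear coefficient in `f` is negative. The values `f < 7` are
-- checked by evaluation, and the shift `f = 7 + y` makes all coefficients positive in each of the
-- four cases below.
separation-from-7 : ∀ h g → (∀ y → Separation h g (7 + y)) →
  {True (allUpTo? (λ f → 12 * (h + g) * f <? (h * g + f + 1) * (4 * f + 3)) 7)} → ∀ f → Separation h g f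
separation-from-7 h g large {small} f with f <? 7
... | yes f<7 = toWitness small f<7
... | no  f≮7 with y , refl ← m≤n⇒∃[o]m+o≡n (≮⇒≥ f≮7) = large y

separation-44 : ∀ f → Separation 4 4 f
separation-44 = separation-from-7 4 4 λ y → m+n≤o⇒m≤o _ (≤-reflexive (eq y))
  where
  eq : ∀ y → 1 + 96 * (7 + y) + (71 + 31 * y + 4 * (y * y)) ≡ (16 + (7 + y) + 1) * (4 * (7 + y) + 3)
  eq = solve-∀

separation-45 : ∀ f → Separation 4 5 f
separation-45 = separation-from-7 4 5 λ y → m+n≤o⇒m≤o _ (≤-reflexive (eq y))
  where
  eq : ∀ y → 1 + 108 * (7 + y) + (111 + 35 * y + 4 * (y * y)) ≡ (20 + (7 + y) + 1) * (4 * (7 + y) + 3)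
  eq = solve-∀

separation-55 : ∀ f → Separation 5 5 f
separation-55 = separation-from-7 5 5 λ y → m+n≤o⇒m≤o _ (≤-reflexive (eq y))
  where
  eq : ∀ y → 1 + 120 * (7 + y) + (182 + 43 * y + 4 * (y * y)) ≡ (25 + (7 + y) + 1) * (4 * (7 + y) + 3)
  eq = solve-∀

separation-56 : ∀ f → Separation 5 6 f
separation-56 = separation-from-7 5 6 λ y → m+n≤o⇒m≤o _ (≤-reflexive (eq y))
  where
  eq : ∀ y → 1 + 132 * (7 + y) + (253 + 51 * y + 4 * (y * y)) ≡ (30 + (7 + y) + 1) * (4 * (7 + y) + 3)
  eq = solve-∀

separation : ∀ {h g} → 4 ≤ h → g ≡ h ⊎ g ≡ suc h → ∀ f → Separation h g f
separation {4} _ (inj₁ refl) = separation-44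
separation {4} _ (inj₂ refl) = separation-45
separation {5} _ (inj₁ refl) = separation-55
separation {5} _ (inj₂ refl) = separation-56
separation {suc (suc (suc (suc (suc (suc k)))))} _ (inj₁ refl) = separation-large k k
separation {suc (suc (suc (suc (suc (suc k)))))} _ (inj₂ refl) = separation-large k (suc k)
separation {1} (s≤s ())
separation {2} (s≤s (s≤s ()))
separation {3} (s≤s (s≤s (s≤s ())))

-- `(h + g)²` exceeds `4hg` by `(g − h)²`, which is 0 or 1.
square-of-halves : ∀ {h g} → g ≡ h ⊎ g ≡ suc h → (h + g) * (h + g) ≤ 4 * (h * g) + 1
square-of-halves {h} (inj₁ refl) = m+n≤o⇒m≤o _ (≤-reflexive (eq h))
  where
  eq : ∀ h → (h + h) * (h + h) + 1 ≡ 4 * (h * h) + 1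
  eq = solve-∀
square-of-halves {h} (inj₂ refl) = ≤-reflexive (eq h)
  where
  eq : ∀ h → (h + (1 + h)) * (h + (1 + h)) ≡ 4 * (h * (1 + h)) + 1
  eq = solve-∀

-- If `D` reached `2 * (h * g + f + 1)`, `Separation` would bound the triangle term strictly by
-- `D * (4 * f + 3)` and `square-of-halves` the other by `(4 * (h * g) + 1) * D`; together these are
-- at most `2 * (D * D)`. As `D` is twice the number of edges, the case `f = 0` is Mantel's bound.
edge-bound : ∀ {h g D f} → 4 ≤ h → g ≡ h ⊎ g ≡ suc h →
  2 * (D * D) ≤ (h + g) * (24 * f + (h + g) * D) → D < 2 * (h * g + f + 1)
edge-bound {h} {g} {D} {f} 4≤h g≈h upper with D <? 2 * (h * g + f + 1)
... | yes small = small
... | no  large = contradiction upper (<⇒≱ (begin-strict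
  (h + g) * (24 * f + (h + g) * D)                       ≡⟨ expand (h + g) f D ⟩
  2 * (12 * (h + g) * f) + (h + g) * (h + g) * D         <⟨ +-mono-<-≤ (*-monoʳ-< 2 (separation 4≤h g≈h f))
                                                                       (*-monoˡ-≤ D (square-of-halves g≈h)) ⟩
  2 * ((h * g + f + 1) * (4 * f + 3)) + (4 * (h * g) + 1) * D
                                                         ≡⟨ cong (_+ (4 * (h * g) + 1) * D) (*-assoc 2 (h * g + f + 1) (4 * f + 3)) ⟨
  2 * (h * g + f + 1) * (4 * f + 3) + (4 * (h * g) + 1) * D
                                                         ≤⟨ +-monoˡ-≤ _ (*-monoˡ-≤ (4 * f + 3) (≮⇒≥ large)) ⟩
  D * (4 * f + 3) + (4 * (h * g) + 1) * D                ≡⟨ collect (h * g) f D ⟩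
  2 * (D * (2 * (h * g + f + 1)))                        ≤⟨ *-monoʳ-≤ 2 (*-monoʳ-≤ D (≮⇒≥ large)) ⟩
  2 * (D * D)                                            ∎))
  where
  open ≤-Reasoning
  expand : ∀ N f D → N * (24 * f + N * D) ≡ 2 * (12 * N * f) + N * N * D
  expand = solve-∀
  collect : ∀ x f D → D * (4 * f + 3) + (4 * x + 1) * D ≡ 2 * (D * (2 * (x + f + 1)))
  collect = solve-∀

-- The pairs inside the halves are all pairs except the `h * g` crossing ones. At most `h * g + f`
-- pairs are edges, and at most `m` are not, so the inner pairs number at most `m + f`.
cover-bound : ∀ {h g D m f} → 4 ≤ h → g ≡ h ⊎ g ≡ suc h →
  (h + g) * (h + g) ≤ D + (h + g) + 2 * m →
  2 * (D * D) ≤ (h + g) * (24 * f + (h + g) * D) →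
  h C 2 + g C 2 ≤ m + f
cover-bound {h} {g} {D} {m} {f} 4≤h g≈h pairs upper =
  -- Everything is doubled and `slack` is added on both sides to avoid subtraction. The strict
  -- comparison with `suc (m + f)` absorbs the `+ 1` of `edge-bound`.
  ≤-pred (*-cancelˡ-< 2 _ _ (+-cancelʳ-< slack _ _ (begin-strict
  2 * (h C 2 + g C 2) + slack                           ≡⟨ regroup (h C 2) (g C 2) h g ⟩
  (2 * (h C 2) + h) + (2 * (g C 2) + g) + 2 * (h * g)   ≡⟨ cong₂ (λ x y → x + y + 2 * (h * g)) (2*nC2+n≡n² h) (2*nC2+n≡n² g) ⟩
  h * h + g * g + 2 * (h * g)                           ≡⟨ square h g ⟩
  (h + g) * (h + g)                                     ≤⟨ pairs ⟩
  D + (h + g) + 2 * m                                   <⟨ +-monoˡ-< (2 * m) (+-monoˡ-< (h + g) (edge-bound 4≤h g≈h upper)) ⟩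
  2 * (h * g + f + 1) + (h + g) + 2 * m                 ≡⟨ assemble m f (h + g) (h * g) ⟩
  2 * suc (m + f) + slack                               ∎)))
  where
  open ≤-Reasoning
  slack = h + g + 2 * (h * g)
  regroup : ∀ x y h g → 2 * (x + y) + (h + g + 2 * (h * g)) ≡ (2 * x + h) + (2 * y + g) + 2 * (h * g)
  regroup = solve-∀
  square : ∀ h g → h * h + g * g + 2 * (h * g) ≡ (h + g) * (h + g)
  square = solve-∀
  assemble : ∀ m f s p → 2 * (p + f + 1) + s + 2 * m ≡ 2 * (1 + (m + f)) + (s + 2 * p)
  assemble = solve-∀

-- Stars and blocks

p⊈q⇒∃ : ∀ {p q : Subset n} → p ⊈ q → ∃ λ x → x ∈ p × x ∉ q
p⊈q⇒∃ {p = p} {q} p⊈q with Fin.any? (λ x → (x ∈? p) ×-dec ¬? (x ∈? q))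
... | yes x∈p∖q = x∈p∖q
... | no  none  = contradiction (λ {x} x∈p → decidable-stable (x ∈? q) λ x∉q → none (x , x∈p , x∉q)) p⊈q

outlier-unique : ∀ {s t : Subset n} {x y} → ∣ s ∣ ≡ 3 → 2 ≤ ∣ s ∩ t ∣ →
  x ∈ s → x ∉ t → y ∈ s → y ∉ t → x ≡ y
outlier-unique {s = s} {t} {x} {y} ∣s∣≡3 2≤∣s∩t∣ x∈s x∉t y∈s y∉t =
  ∣p∣≤1⇒x≡y (+-cancelˡ-≤ 2 _ _ (begin
    2 + ∣ s ∩ ∁ t ∣             ≤⟨ +-monoˡ-≤ _ 2≤∣s∩t∣ ⟩
    ∣ s ∩ t ∣ + ∣ s ∩ ∁ t ∣     ≡⟨ ∣p∩q∣+∣p∩∁q∣≡∣p∣ s t ⟩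
    ∣ s ∣                       ≡⟨ ∣s∣≡3 ⟩
    3                           ∎))
    (x∈p∩q⁺ (x∈s , x∉p⇒x∈∁p x∉t)) (x∈p∩q⁺ (y∈s , x∉p⇒x∈∁p y∉t))
  where open ≤-Reasoning

-- The bound `∣ Q ∣ ≤ 4` lets the empty family count as a block.
Star Block : Pred (Subset n) 0ℓ → Set
Star  F = ∃ λ P → ∣ P ∣ ≡ 2 × (∀ s → F s → P ⊆ s)
Block F = ∃ λ Q → ∣ Q ∣ ≤ 4 × (∀ s → F s → s ⊆ Q)

module _ {F : Pred (Subset n) 0ℓ} (F? : Decidable F) (clique : IsClique n 3 F) where

  private
    size = proj₁ clique

    meet : ∀ {s t} → F s → F t → 2 ≤ ∣ s ∩ t ∣
    meet {s} {t} Fs Ft with s ⊆? t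
    ... | no  s⊈t = ≤-reflexive (sym (proj₂ clique s t Fs Ft λ { refl → s⊈t id }))
    ... | yes s⊆t = ≤-trans (≤-trans (n≤1+n 2) (≤-reflexive (sym (size s Fs))))
                            (p⊆q⇒∣p∣≤∣q∣ λ x∈s → x∈p∩q⁺ (x∈s , s⊆t x∈s))

    -- Since `u` has at most one element outside `t`, and that is `e`, it misses `d`. Then `d` is
    -- the only element of `s` outside `u`, so all of `s ∩ t` lies in `u`.
    outsider-contains-∩ : ∀ {s t u d e x} → F s → F t → F u → d ∈ s → d ∉ t →
      e ∈ u → e ∉ s ∪ t → x ∈ s ∩ t → x ∈ u
    outsider-contains-∩ {s} {t} {u} {d} {e} {x} Fs Ft Fu d∈s d∉t e∈u e∉s∪t x∈s∩t
      with x∈s , x∈t ← x∈p∩q⁻ s t x∈s∩t = decidable-stable (x ∈? u) λ x∉u →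
        let d∉u : d ∉ u
            d∉u d∈u = e∉s∪t (x∈p∪q⁺ (inj₁ (subst (_∈ s)
              (outlier-unique (size u Fu) (meet Fu Ft) d∈u d∉t e∈u (e∉s∪t ∘ x∈p∪q⁺ ∘ inj₂)) d∈s)))
        in d∉t (subst (_∈ t) (outlier-unique (size s Fs) (meet Fs Fu) x∈s x∉u d∈s d∉u) x∈t)

  -- s, t and u ⊉ s ∩ t lie in the four-set s ∪ t.  A member v with e ∈ v ∖ (s ∪ t)
  -- would contain s ∩ t, so v ∖ u would have two elements: e and one of s ∩ t.
  star-or-block : Star F ⊎ Block F
  star-or-block with anySubset? F?
  ... | no none = inj₂ (⊥ , ≤-trans (≤-reflexive (∣⊥∣≡0 n)) z≤n , λ s Fs → contradiction (s , Fs) none)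
  ... | yes (s , Fs) with anySubset? (λ t → F? t ×-dec ¬? (s ⊆? t))
  -- Every member contains `s`, so any two elements of `s` serve as a centre.
  ...   | no none =
    let x , x∈s = 0<∣p∣⇒Nonempty {p = s} (subst (0 <_) (sym (size s Fs)) z<s)
    in  inj₁ (s - x , suc-injective (trans (x∈p⇒1+∣p-x∣≡∣p∣ {p = s} x∈s) (size s Fs)) ,
              λ t Ft y∈ → decidable-stable (s ⊆? t) (λ s⊈t → none (t , Ft , s⊈t)) (p─q⊆p s ⁅ x ⁆ y∈))
  ...   | yes (t , Ft , s⊈t) with anySubset? (λ u → F? u ×-dec ¬? ((s ∩ t) ⊆? u))
  ...     | no none = inj₁ (s ∩ t , proj₂ clique s t Fs Ft (λ { refl → s⊈t id }) ,
              λ u Fu → decidable-stable ((s ∩ t) ⊆? u) (λ ⊈u → none (u , Fu , ⊈u)))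
  ...     | yes (u , Fu , ⊈u) with d , d∈s , d∉t ← p⊈q⇒∃ s⊈t | x , x∈s∩t , x∉u ← p⊈q⇒∃ ⊈u =
    inj₂ (s ∪ t , ≤-reflexive ∣s∪t∣≡4 , λ v Fv {e} e∈v → decidable-stable (e ∈? s ∪ t) λ e∉ →
      let e∉u : e ∉ u
          e∉u e∈u = x∉u (outsider-contains-∩ Fs Ft Fu d∈s d∉t e∈u e∉ x∈s∩t)
          x∈v     = outsider-contains-∩ Fs Ft Fv d∈s d∉t e∈v e∉ x∈s∩t
          x≡e     = outlier-unique (size v Fv) (meet Fv Fu) x∈v x∉u e∈v e∉u
      in e∉ (p⊆p∪q t (p∩q⊆p s t (subst (_∈ s ∩ t) x≡e x∈s∩t))))
    where
    ∣s∪t∣≡4 : ∣ s ∪ t ∣ ≡ 4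
    ∣s∪t∣≡4 = +-cancelʳ-≡ 2 ∣ s ∪ t ∣ 4 (begin
      ∣ s ∪ t ∣ + 2             ≡⟨ cong (∣ s ∪ t ∣ +_) (proj₂ clique s t Fs Ft (λ { refl → s⊈t id })) ⟨
      ∣ s ∪ t ∣ + ∣ s ∩ t ∣     ≡⟨ ∣p∪q∣+∣p∩q∣≡∣p∣+∣q∣ s t ⟩
      ∣ s ∣ + ∣ t ∣             ≡⟨ cong₂ _+_ (size s Fs) (size t Ft) ⟩
      6                         ∎)
      where open ≡-Reasoning

-- Counting ordered pairs and triples by indicators

indicator : Subset n → Fin n → ℕ
indicator p i with Vec.lookup p i
... | true  = 1
... | false = 0

x∈p⇒indicator≡1 : ∀ {p : Subset n} {x} → x ∈ p → indicator p x ≡ 1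
x∈p⇒indicator≡1 x∈p rewrite []=⇒lookup x∈p = refl

sum-indicator* : ∀ (p : Subset n) {f : Fin n → ℕ} {b} → (∀ {i} → i ∈ p → f i ≤ b) →
  ∑[ i < n ] (indicator p i * f i) ≤ ∣ p ∣ * b
sum-indicator* []          f≤b = z≤n
sum-indicator* (true ∷ p)  f≤b =
  +-mono-≤ (≤-trans (≤-reflexive (*-identityˡ _)) (f≤b here)) (sum-indicator* p (f≤b ∘ there))
sum-indicator* (false ∷ p) f≤b = sum-indicator* p (f≤b ∘ there)

sum-indicator : ∀ (p : Subset n) → sum (indicator p) ≡ ∣ p ∣
sum-indicator []          = refl
sum-indicator (true ∷ p)  = cong suc (sum-indicator p)
sum-indicator (false ∷ p) = sum-indicator p

∣p-x∣≤ : ∀ {p : Subset n} {b x} → ∣ p ∣ ≤ suc b → x ∈ p → ∣ p - x ∣ ≤ b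
∣p-x∣≤ ∣p∣≤ x∈p = ≤-pred (≤-trans (x∈p⇒∣p-x∣<∣p∣ x∈p) ∣p∣≤)

-- Value 1 on ordered pairs of distinct elements of `p`, and 0 elsewhere. Deleting `i` before
-- choosing `j` makes the sums factor into falling products such as `∣ p ∣ * (∣ p ∣ ∸ 1)`.
pairs : Subset n → Fin n → Fin n → ℕ
pairs p i j = indicator p i * indicator (p - i) j

triples : Subset n → Fin n → Fin n → Fin n → ℕ
triples p i j k = indicator p i * pairs (p - i) j k

pairs≡1 : ∀ {p : Subset n} {i j} → i ∈ p → j ∈ p → i ≢ j → pairs p i j ≡ 1
pairs≡1 i∈p j∈p i≢j
  rewrite x∈p⇒indicator≡1 i∈p | x∈p⇒indicator≡1 (x∈p∧x≢y⇒x∈p-y j∈p (i≢j ∘ sym)) = refl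

triples≡1 : ∀ {p : Subset n} {i j k} → i ∈ p → j ∈ p → k ∈ p → i ≢ j → i ≢ k → j ≢ k → triples p i j k ≡ 1
triples≡1 i∈p j∈p k∈p i≢j i≢k j≢k
  rewrite x∈p⇒indicator≡1 i∈p
        | pairs≡1 (x∈p∧x≢y⇒x∈p-y j∈p (i≢j ∘ sym)) (x∈p∧x≢y⇒x∈p-y k∈p (i≢k ∘ sym)) j≢k = refl

sum-pairs : ∀ (p : Subset n) {b} → ∣ p ∣ ≤ suc b → ∑[ i < n ] ∑[ j < n ] pairs p i j ≤ suc b * b
sum-pairs {n} p {b} ∣p∣≤ = begin
  ∑[ i < n ] ∑[ j < n ] pairs p i j             ≡⟨ sum-cong-≗ (λ i → *-distribˡ-sum (indicator p i) (indicator (p - i))) ⟨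
  ∑[ i < n ] (indicator p i * sum (indicator (p - i)))
    ≤⟨ sum-indicator* p (λ {i} i∈p → ≤-trans (≤-reflexive (sum-indicator (p - i))) (∣p-x∣≤ ∣p∣≤ i∈p)) ⟩
  ∣ p ∣ * b                                     ≤⟨ *-monoˡ-≤ b ∣p∣≤ ⟩
  suc b * b                                     ∎
  where open ≤-Reasoning

sum-triples : ∀ (p : Subset n) {b} → ∣ p ∣ ≤ 2 + b →
  ∑[ i < n ] ∑[ j < n ] ∑[ k < n ] triples p i j k ≤ (2 + b) * (suc b * b)
sum-triples {n} p {b} ∣p∣≤ = begin
  ∑[ i < n ] ∑[ j < n ] ∑[ k < n ] triples p i j k
    ≡⟨ sum-cong-≗ (λ i → trans (*-distribˡ-sum (indicator p i) (λ j → ∑[ k < n ] pairs (p - i) j k))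
         (sum-cong-≗ λ j → *-distribˡ-sum (indicator p i) (λ k → pairs (p - i) j k))) ⟨
  ∑[ i < n ] (indicator p i * ∑[ j < n ] ∑[ k < n ] pairs (p - i) j k)
    ≤⟨ sum-indicator* p (λ {i} i∈p → sum-pairs (p - i) (∣p-x∣≤ ∣p∣≤ i∈p)) ⟩
  ∣ p ∣ * (suc b * b)                           ≤⟨ *-monoˡ-≤ (suc b * b) ∣p∣≤ ⟩
  (2 + b) * (suc b * b)                         ∎
  where open ≤-Reasoning

module _ {F : Pred (Subset n) 0ℓ} where

  stars blocks : Star F ⊎ Block F → ℕ
  stars  (inj₁ _) = 1
  stars  (inj₂ _) = 0
  blocks (inj₁ _) = 0
  blocks (inj₂ _) = 1

  star-pairs : Star F ⊎ Block F → Fin n → Fin n → ℕ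
  star-pairs (inj₁ (P , _)) = pairs P
  star-pairs (inj₂ _) _ _   = 0

  block-triples : Star F ⊎ Block F → Fin n → Fin n → Fin n → ℕ
  block-triples (inj₁ _) _ _ _ = 0
  block-triples (inj₂ (Q , _)) = triples Q

  stars+blocks≡1 : ∀ c → stars c + blocks c ≡ 1
  stars+blocks≡1 (inj₁ _) = refl
  stars+blocks≡1 (inj₂ _) = refl

  sum-star-pairs : ∀ c → ∑[ i < n ] ∑[ j < n ] star-pairs c i j ≤ 2 * stars c
  sum-star-pairs (inj₁ (P , ∣P∣≡2 , _)) = sum-pairs P (≤-reflexive ∣P∣≡2)
  sum-star-pairs (inj₂ _) = ≤-reflexive (sum-zero {n} λ i → sum-zero {n} λ j → refl)

  -- A four-set has 4 · 3 · 2 = 24 ordered triples of distinct elements.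
  sum-block-triples : ∀ c → ∑[ i < n ] ∑[ j < n ] ∑[ k < n ] block-triples c i j k ≤ 24 * blocks c
  sum-block-triples (inj₂ (Q , ∣Q∣≤4 , _)) = sum-triples Q ∣Q∣≤4
  sum-block-triples (inj₁ _) =
    ≤-reflexive (sum-zero {n} λ i → sum-zero {n} λ j → sum-zero {n} λ k → refl)

  -- The centre of a star containing the triple would be one of its three pairs, but none of these
  -- is starred by `c`. Hence `c` is a block, and its four-set contains the triple.
  triple-in-block : ∀ c {i j k} → i ≢ j → i ≢ k → j ≢ k → F ((⁅ i ⁆ ∪ ⁅ j ⁆) ∪ ⁅ k ⁆) →
    star-pairs c i j ≡ 0 → star-pairs c i k ≡ 0 → star-pairs c k j ≡ 0 → block-triples c i j k ≡ 1
  triple-in-block (inj₂ (Q , _ , s⊆Q)) {i} {j} {k} i≢j i≢k j≢k Fs _ _ _ =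
    triples≡1 (s⊆Q _ Fs (x∈p∪q⁺ (inj₁ (x∈p∪q⁺ (inj₁ (x∈⁅x⁆ i))))))
              (s⊆Q _ Fs (x∈p∪q⁺ (inj₁ (x∈p∪q⁺ (inj₂ (x∈⁅x⁆ j))))))
              (s⊆Q _ Fs (x∈p∪q⁺ (inj₂ (x∈⁅x⁆ k)))) i≢j i≢k j≢k
  triple-in-block (inj₁ (P , ∣P∣≡2 , P⊆)) {i} {j} {k} i≢j i≢k j≢k Fs ij ik kj
    with x , y , x∈P , y∈P , x≢y ← 2≤∣p∣⇒distinct (≤-reflexive (sym ∣P∣≡2))
    = contradiction y∈P (excluded (cases (P⊆ _ Fs x∈P)) (cases (P⊆ _ Fs y∈P)))
    where
    cases : ∀ {z} → z ∈ (⁅ i ⁆ ∪ ⁅ j ⁆) ∪ ⁅ k ⁆ → z ≡ i ⊎ z ≡ j ⊎ z ≡ k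
    cases z∈ with x∈p∪q⁻ (⁅ i ⁆ ∪ ⁅ j ⁆) ⁅ k ⁆ z∈
    ... | inj₂ z∈k = inj₂ (inj₂ (x∈⁅y⁆⇒x≡y k z∈k))
    ... | inj₁ z∈ij with x∈p∪q⁻ ⁅ i ⁆ ⁅ j ⁆ z∈ij
    ...   | inj₁ z∈i = inj₁ (x∈⁅y⁆⇒x≡y i z∈i)
    ...   | inj₂ z∈j = inj₂ (inj₁ (x∈⁅y⁆⇒x≡y j z∈j))
    apart : ∀ {a b} → pairs P a b ≡ 0 → a ≢ b → a ∈ P → b ∉ P
    apart ab≡0 a≢b a∈P b∈P = contradiction (trans (sym ab≡0) (pairs≡1 a∈P b∈P a≢b)) λ ()
    excluded : x ≡ i ⊎ x ≡ j ⊎ x ≡ k → y ≡ i ⊎ y ≡ j ⊎ y ≡ k → y ∉ P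
    excluded (inj₁ refl)        (inj₁ refl)        y∈P = x≢y refl
    excluded (inj₁ refl)        (inj₂ (inj₁ refl)) y∈P = apart ij x≢y x∈P y∈P
    excluded (inj₁ refl)        (inj₂ (inj₂ refl)) y∈P = apart ik x≢y x∈P y∈P
    excluded (inj₂ (inj₁ refl)) (inj₁ refl)        y∈P = apart ij (x≢y ∘ sym) y∈P x∈P
    excluded (inj₂ (inj₁ refl)) (inj₂ (inj₁ refl)) y∈P = x≢y refl
    excluded (inj₂ (inj₁ refl)) (inj₂ (inj₂ refl)) y∈P = apart kj (x≢y ∘ sym) y∈P x∈P
    excluded (inj₂ (inj₂ refl)) (inj₁ refl)        y∈P = apart ik (x≢y ∘ sym) y∈P x∈P
    excluded (inj₂ (inj₂ refl)) (inj₂ (inj₁ refl)) y∈P = apart kj x≢y x∈P y∈P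
    excluded (inj₂ (inj₂ refl)) (inj₂ (inj₂ refl)) y∈P = x≢y refl

-- Double counting over the cliques of a cover

-- Cliques in a cover need not be decidable, so they are replaced by the fibres of
-- the map sending each vertex to the clique that the cover provides for it.
module Fibres {N} (L : List (VSet N)) (isCover : IsCliqueCover N 3 L) where

  Fibre : Fin (length L) → VSet N
  Fibre c s = ∃ λ ∣s∣≡3 → Any.index (proj₂ isCover s ∣s∣≡3) ≡ c

  Fibre? : ∀ c → Decidable (Fibre c)
  Fibre? c s with ∣ s ∣ ≟ 3
  ... | no  ∣s∣≢3 = no (∣s∣≢3 ∘ proj₁)
  -- The index depends on a proof of `∣ s ∣ ≡ 3`; such proofs are unique, so testing one of them
  -- decides membership.
  ... | yes ∣s∣≡3 = map′ (∣s∣≡3 ,_) (λ { (p , eq) → subst _ (≡-irrelevant p ∣s∣≡3) eq })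
                         (Any.index (proj₂ isCover s ∣s∣≡3) Fin.≟ c)

  Fibre⊆lookup : ∀ c s → Fibre c s → lookup L c s
  Fibre⊆lookup _ s (∣s∣≡3 , refl) = Any.lookup-index (proj₂ isCover s ∣s∣≡3)

  Fibre-isClique : ∀ c → IsClique N 3 (Fibre c)
  Fibre-isClique c = (λ s → proj₁) , λ s t s∈ t∈ →
    proj₂ (All.lookup (proj₁ isCover) (∈-lookup {xs = L} c)) s t (Fibre⊆lookup c s s∈) (Fibre⊆lookup c t t∈)

  kind : ∀ c → Star (Fibre c) ⊎ Block (Fibre c)
  kind c = star-or-block (Fibre? c) (Fibre-isClique c)

  m f : ℕ
  m = ∑[ c < length L ] stars (kind c)
  f = ∑[ c < length L ] blocks (kind c)

  m+f≡length : m + f ≡ length L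
  m+f≡length = begin
    m + f                                             ≡⟨ ∑-distrib-+ (stars ∘ kind) (blocks ∘ kind) ⟨
    ∑[ c < length L ] (stars (kind c) + blocks (kind c)) ≡⟨ sum-cong-≗ (stars+blocks≡1 ∘ kind) ⟩
    ∑[ c < length L ] 1                               ≡⟨ sum-const (length L) 1 ⟩
    length L * 1                                      ≡⟨ *-identityʳ (length L) ⟩
    length L                                          ∎
    where open ≡-Reasoning

  starred : Fin N → Fin N → ℕ
  starred i j = ∑[ c < length L ] star-pairs (kind c) i j

  -- The diagonal is included so that `edge` has no loops. A pair may be the centre of several
  -- stars, so this can exceed 1; the truncated subtraction in `edge` still yields 0 or 1.
  non-edge : Fin N → Fin N → ℕ
  non-edge i j = indicator ⁅ i ⁆ j + starred i j

  edge : Fin N → Fin N → ℕ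
  edge i j = 1 ∸ non-edge i j

  -- Ordered counts: each edge appears twice in `D` and each triangle six times in `T`.
  D T : ℕ
  D = ∑[ i < N ] ∑[ j < N ] edge i j
  T = ∑[ i < N ] ∑[ j < N ] ∑[ k < N ] (edge i j * (edge i k * edge k j))

  sum-starred : ∑[ i < N ] ∑[ j < N ] starred i j ≤ 2 * m
  sum-starred = begin
    ∑[ i < N ] ∑[ j < N ] ∑[ c < length L ] star-pairs (kind c) i j
      ≡⟨ sum-cong-≗ (λ i → ∑-comm λ j c → star-pairs (kind c) i j) ⟩
    ∑[ i < N ] ∑[ c < length L ] ∑[ j < N ] star-pairs (kind c) i j
      ≡⟨ ∑-comm (λ i c → ∑[ j < N ] star-pairs (kind c) i j) ⟩
    ∑[ c < length L ] ∑[ i < N ] ∑[ j < N ] star-pairs (kind c) i j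
      ≤⟨ sum-mono (sum-star-pairs ∘ kind) ⟩
    ∑[ c < length L ] (2 * stars (kind c))
      ≡⟨ *-distribˡ-sum 2 (stars ∘ kind) ⟨
    2 * m ∎
    where open ≤-Reasoning

  -- Every ordered pair is an edge or a non-edge; the non-edges are the `N` diagonal pairs and at
  -- most two orderings of each star's centre.
  pairs-bound : N * N ≤ D + N + 2 * m
  pairs-bound = begin
    N * N                                                ≡⟨ cong (N *_) (*-identityʳ N) ⟨
    N * (N * 1)                                          ≡⟨ trans (sum-cong-≗ {N} λ i → sum-const N 1) (sum-const N (N * 1)) ⟨
    ∑[ i < N ] ∑[ j < N ] 1                              ≤⟨ sum-mono (λ i → sum-mono λ j → ≤-trans (m≤n+m∸n 1 (non-edge i j)) (≤-reflexive (+-comm (non-edge i j) _))) ⟩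
    ∑[ i < N ] ∑[ j < N ] (edge i j + non-edge i j)      ≡⟨ split edge non-edge ⟩
    D + ∑[ i < N ] ∑[ j < N ] non-edge i j               ≡⟨ cong (D +_) (split (λ i → indicator ⁅ i ⁆) starred) ⟩
    D + (∑[ i < N ] sum (indicator ⁅ i ⁆) + ∑[ i < N ] ∑[ j < N ] starred i j)
      ≤⟨ +-monoʳ-≤ D (+-mono-≤ (≤-reflexive diagonal) sum-starred) ⟩
    D + (N + 2 * m)                                      ≡⟨ +-assoc D N (2 * m) ⟨
    D + N + 2 * m                                        ∎
    where
    open ≤-Reasoning
    split : (g h : Fin N → Fin N → ℕ) →
      ∑[ i < N ] ∑[ j < N ] (g i j + h i j) ≡ ∑[ i < N ] ∑[ j < N ] g i j + ∑[ i < N ] ∑[ j < N ] h i j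
    split g h = trans (sum-cong-≗ λ i → ∑-distrib-+ (g i) (h i)) (∑-distrib-+ (sum ∘ g) (sum ∘ h))
    diagonal : ∑[ i < N ] sum (indicator ⁅ i ⁆) ≡ N
    diagonal = trans (sum-cong-≗ {N} λ i → trans (sum-indicator ⁅ i ⁆) (∣⁅x⁆∣≡1 i))
                     (trans (sum-const N 1) (*-identityʳ N))

  no-edge-or-unstarred : ∀ i j → edge i j ≡ 0 ⊎ (i ≢ j × (∀ c → star-pairs (kind c) i j ≡ 0))
  no-edge-or-unstarred i j with non-edge i j in eq
  ... | suc x = inj₁ (0∸n≡0 x)
  ... | zero  = inj₂ ((λ { refl → contradiction (trans (sym (x∈p⇒indicator≡1 (x∈⁅x⁆ i))) (m+n≡0⇒m≡0 _ eq)) λ () })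
                     , λ c → n≤0⇒n≡0 (≤-trans (term≤sum (λ c → star-pairs (kind c) i j) c)
                                              (≤-reflexive (m+n≡0⇒n≡0 (indicator ⁅ i ⁆ j) eq))))

  -- The fibre containing the triple of a triangle must be a block by `triple-in-block`, so it
  -- contributes 1 to the right-hand sum.
  triangle≤block-triples : ∀ i j k →
    edge i j * (edge i k * edge k j) ≤ ∑[ c < length L ] block-triples (kind c) i j k
  triangle≤block-triples i j k
    with no-edge-or-unstarred i j | no-edge-or-unstarred i k | no-edge-or-unstarred k j
  ... | inj₁ ij≡0 | _ | _ rewrite ij≡0 = z≤n
  ... | inj₂ _ | inj₁ ik≡0 | _ rewrite ik≡0 | *-zeroʳ (edge i j) = z≤n
  ... | inj₂ _ | inj₂ _ | inj₁ kj≡0 rewrite kj≡0 | *-zeroʳ (edge i k) | *-zeroʳ (edge i j) = z≤n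
  ... | inj₂ (i≢j , ij) | inj₂ (i≢k , ik) | inj₂ (k≢j , kj) = begin
    edge i j * (edge i k * edge k j)
      ≤⟨ *-mono-≤ (m∸n≤m 1 (non-edge i j)) (*-mono-≤ (m∸n≤m 1 (non-edge i k)) (m∸n≤m 1 (non-edge k j))) ⟩
    1
      ≡⟨ triple-in-block (kind c) i≢j i≢k (k≢j ∘ sym) (∣ijk∣≡3 , refl) (ij c) (ik c) (kj c) ⟨
    block-triples (kind c) i j k
      ≤⟨ term≤sum (λ c → block-triples (kind c) i j k) c ⟩
    ∑[ c < length L ] block-triples (kind c) i j k ∎
    where
    open ≤-Reasoning
    k∉ij : k ∉ ⁅ i ⁆ ∪ ⁅ j ⁆
    k∉ij k∈ with x∈p∪q⁻ ⁅ i ⁆ ⁅ j ⁆ k∈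
    ... | inj₁ k∈i = i≢k (sym (x∈⁅y⁆⇒x≡y i k∈i))
    ... | inj₂ k∈j = k≢j (x∈⁅y⁆⇒x≡y j k∈j)
    ∣ijk∣≡3 : ∣ (⁅ i ⁆ ∪ ⁅ j ⁆) ∪ ⁅ k ⁆ ∣ ≡ 3
    ∣ijk∣≡3 = trans (x∉p⇒∣p∪⁅x⁆∣≡1+∣p∣ k∉ij)
      (cong suc (trans (x∉p⇒∣p∪⁅x⁆∣≡1+∣p∣ (x≢y⇒x∉⁅y⁆ (i≢j ∘ sym))) (cong suc (∣⁅x⁆∣≡1 i))))
    -- The clique that the cover assigns to this triple, so that membership in `Fibre c` holds by
    -- `refl`.
    c = Any.index (proj₂ isCover ((⁅ i ⁆ ∪ ⁅ j ⁆) ∪ ⁅ k ⁆) ∣ijk∣≡3)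

  triangles-bound : T ≤ 24 * f
  triangles-bound = begin
    T
      ≤⟨ sum-mono (λ i → sum-mono λ j → sum-mono (triangle≤block-triples i j)) ⟩
    ∑[ i < N ] ∑[ j < N ] ∑[ k < N ] ∑[ c < length L ] block-triples (kind c) i j k
      ≡⟨ sum-cong-≗ (λ i → sum-cong-≗ λ j → ∑-comm λ k c → block-triples (kind c) i j k) ⟩
    ∑[ i < N ] ∑[ j < N ] ∑[ c < length L ] ∑[ k < N ] block-triples (kind c) i j k
      ≡⟨ sum-cong-≗ (λ i → ∑-comm λ j c → ∑[ k < N ] block-triples (kind c) i j k) ⟩
    ∑[ i < N ] ∑[ c < length L ] ∑[ j < N ] ∑[ k < N ] block-triples (kind c) i j k
      ≡⟨ ∑-comm (λ i c → ∑[ j < N ] ∑[ k < N ] block-triples (kind c) i j k) ⟩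
    ∑[ c < length L ] ∑[ i < N ] ∑[ j < N ] ∑[ k < N ] block-triples (kind c) i j k
      ≤⟨ sum-mono (sum-block-triples ∘ kind) ⟩
    ∑[ c < length L ] (24 * blocks (kind c))
      ≡⟨ *-distribˡ-sum 24 (blocks ∘ kind) ⟨
    24 * f ∎
    where open ≤-Reasoning

  goodman-bound : 2 * (D * D) ≤ N * (24 * f + N * D)
  goodman-bound = ≤-trans (goodman edge (λ i j → m∸n≤m 1 (non-edge i j)))
                          (*-monoʳ-≤ N (+-monoˡ-≤ (N * D) triangles-bound))

-- Minimality for the two halves

N∸N/2≈N/2 : ∀ N → N ∸ N / 2 ≡ N / 2 ⊎ N ∸ N / 2 ≡ suc (N / 2)
N∸N/2≈N/2 N with N % 2 | m≡m%n+[m/n]*n N 2 | m%n<n N 2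
... | suc (suc _) | _ | s≤s (s≤s ())
... | 0 | N≡ | _ = inj₁ (trans (cong (_∸ N / 2) (trans N≡ (h*2≡h+h (N / 2)))) (m+n∸n≡m (N / 2) (N / 2)))
  where
  h*2≡h+h : ∀ h → h * 2 ≡ h + h
  h*2≡h+h = solve-∀
... | 1 | N≡ | _ = inj₂ (trans (cong (_∸ N / 2) (trans N≡ (1+h*2≡1+h+h (N / 2)))) (m+n∸n≡m (suc (N / 2)) (N / 2)))
  where
  1+h*2≡1+h+h : ∀ h → 1 + h * 2 ≡ 1 + h + h
  1+h*2≡1+h+h = solve-∀

length-CN≤length : ∀ {N} → 7 < N → (L : List (VSet N)) → IsCliqueCover N 3 L → length (CN N) ≤ length L
length-CN≤length {N} 7<N L isCover = begin
  length (CN N)                     ≤⟨ length-CN≤ N ⟩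
  -- Halving `8 ≤ N` gives `4 ≤ N / 2`, the size that `separation` requires.
  (N / 2) C 2 + (N ∸ N / 2) C 2     ≤⟨ cover-bound {D = D} {m} {f} (/-monoˡ-≤ 2 7<N) (N∸N/2≈N/2 N)
                                         (subst (λ N′ → N′ * N′ ≤ D + N′ + 2 * m) parts pairs-bound)
                                         (subst (λ N′ → 2 * (D * D) ≤ N′ * (24 * f + N′ * D)) parts goodman-bound) ⟩
  m + f                             ≡⟨ m+f≡length ⟩
  length L                          ∎
  where
  open ≤-Reasoning
  open Fibres L isCover
  parts : N ≡ N / 2 + (N ∸ N / 2)
  parts = sym (m+[n∸m]≡n (m/n≤m N 2))

theorem2p6 : (N : ℕ) → 3 < N →
    IsCliqueCover N 3 (CN N) ×
    (7 < N → (L : List (VSet N)) → IsCliqueCover N 3 L → length (CN N) ≤ length L)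
theorem2p6 N _ = CN-isCliqueCover N , length-CN≤length
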